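{- Let $X$ be the higher inductive type with constructors $\mathrm{pt} : X$, $a, b : \Omega X$, $r : a^5 = b^3$, and $s : b^3 = (ab)^2$. Then $X$ is acyclic.
   Context: We work in homotopy type theory (HoTT) in the style of the HoTT Book: dependent type theory with univalent universes (hence function extensionality) and higher inductive types; no classical axioms are assumed. $\Omega X$ denotes the loop type $(\mathrm{pt} =_X \mathrm{pt})$; products and powers of loops are with respect to path concatenation. The suspension $\Sigma A$ of a type $A$ is the pushout of $\mathbf{1} \leftarrow A \to \mathbf{1}$. A type is acyclic if its suspension is contractible. -}

{-# OPTIONS --without-K #-}
-- Book HoTT is developed here as Martin-Löf type theory without K, with the
-- higher inductive types given as structure: a carrier, constructors, and
-- dependent elimination into every universe.  Computation rules, including
-- those for points, hold up to identification only; univalence is not assumed.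
module Defs where

open import Data.Nat.Base using (ℕ; zero; suc)
open import Data.Product.Base using (Σ)
open import Data.Unit.Base using (tt)
open import Level using (Level; Setω; _⊔_)
open import Relation.Binary.PropositionalEquality.Core using (_≡_; refl; trans; cong; subst; subst₂)
open import Relation.Binary.PropositionalEquality.Properties using (dcong)

private
  variable
    ℓ ℓ′ ℓa ℓb ℓc : Level
    A : Set ℓ
    P : A → Set ℓ′
    x y z : A

isContr : Set ℓ → Set ℓ
isContr A = Σ A λ c → ∀ x → c ≡ x

Ω : (A : Set ℓ) → A → Set ℓ
Ω A x = x ≡ x

infixr 7 _∙_ _∙ᵈ_
infix 8 _^_ _^ᵈ_

_∙_ : x ≡ y → y ≡ z → x ≡ z
_∙_ = trans

_^_ : {A : Set ℓ} {x : A} → Ω A x → ℕ → Ω A x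
p ^ zero  = refl
p ^ suc n = p ∙ p ^ n

PathOver : (P : A → Set ℓ′) → x ≡ y → P x → P y → Set ℓ′
PathOver P p u v = subst P p u ≡ v

PathOver² : (P : A → Set ℓ′) {p q : x ≡ y} {u : P x} {v : P y} →
            p ≡ q → PathOver P p u v → PathOver P q u v → Set ℓ′
PathOver² P {u = u} {v} r = PathOver (λ p → PathOver P p u v) r

_∙ᵈ_ : {p : x ≡ y} {q : y ≡ z} {u : P x} {v : P y} {w : P z} →
       PathOver P p u v → PathOver P q v w → PathOver P (p ∙ q) u w
_∙ᵈ_ {P = P} {p = refl} {q} h k = cong (subst P q) h ∙ k

_^ᵈ_ : {p : Ω A x} {u : P x} → PathOver P p u u → (n : ℕ) → PathOver P (p ^ n) u u
h ^ᵈ zero  = refl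
_^ᵈ_ {P = P} {p = p} h (suc n) = _∙ᵈ_ {P = P} {p = p} h (_^ᵈ_ {P = P} h n)

module _ {A : Set ℓ} {P : A → Set ℓ′} (f : ∀ x → P x) where

  dcong-∙ : {x y z : A} (p : x ≡ y) (q : y ≡ z) →
            dcong f (p ∙ q) ≡ _∙ᵈ_ {P = P} {p = p} (dcong f p) (dcong f q)
  dcong-∙ refl q = refl

  dcong-^ : {x : A} (p : Ω A x) (n : ℕ) →
            dcong f (p ^ n) ≡ _^ᵈ_ {P = P} (dcong f p) n
  dcong-^ p zero    = refl
  dcong-^ p (suc n) = dcong-∙ p (p ^ n) ∙
                      cong (_∙ᵈ_ {P = P} {p = p} (dcong f p)) (dcong-^ p n)

record XConstructors (X : Set ℓ) : Set ℓ where
  field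
    pt : X
    a  : Ω X pt
    b  : Ω X pt
    r  : a ^ 5 ≡ b ^ 3
    s  : b ^ 3 ≡ (a ∙ b) ^ 2

-- The premises of the induction principle for a family P.
record XMethods {X : Set ℓ} (con : XConstructors X) (P : X → Set ℓ′) : Set ℓ′ where
  open XConstructors con
  field
    pt′ : P pt
    a′  : PathOver P a pt′ pt′
    b′  : PathOver P b pt′ pt′
    r′  : PathOver² P r (_^ᵈ_ {P = P} a′ 5) (_^ᵈ_ {P = P} b′ 3)
    s′  : PathOver² P s (_^ᵈ_ {P = P} b′ 3)
                        (_^ᵈ_ {P = P} (_∙ᵈ_ {P = P} {p = a} a′ b′) 2)

-- The values of f at the constructors; f applied to a composite loop is
-- rewritten as the corresponding composite over it.
values : {X : Set ℓ} (con : XConstructors X) {P : X → Set ℓ′} → (∀ x → P x) → XMethods con P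
values con {P} f = record
  { pt′ = f pt
  ; a′  = dcong f a
  ; b′  = dcong f b
  ; r′  = subst₂ (PathOver² P r) (dcong-^ f a 5) (dcong-^ f b 3) (dcong (dcong f) r)
  ; s′  = subst₂ (PathOver² P s) (dcong-^ f b 3)
            (dcong-^ f (a ∙ b) 2 ∙ cong (λ h → _^ᵈ_ {P = P} h 2) (dcong-∙ f a b))
            (dcong (dcong f) s)
  }
  where open XConstructors con

record XHIT (ℓ : Level) : Setω where
  field
    X            : Set ℓ
    constructors : XConstructors X
    -- All five computation rules at once: an identification of records of
    -- methods is an identification at pt together with identifications over it
    -- at a, b, r and s.
    ind   : {ℓ′ : Level} (P : X → Set ℓ′) → XMethods constructors P → ∀ x → P x
    ind-β : {ℓ′ : Level} (P : X → Set ℓ′) (m : XMethods constructors P) →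
            values constructors (ind P m) ≡ m

record PushoutConstructors {A : Set ℓa} {B : Set ℓb} {C : Set ℓc} (f : C → A) (g : C → B)
                           {ℓ : Level} (D : Set ℓ) : Set (ℓa ⊔ ℓb ⊔ ℓc ⊔ ℓ) where
  field
    inl  : A → D
    inr  : B → D
    glue : ∀ c → inl (f c) ≡ inr (g c)

record PushoutMethods {A : Set ℓa} {B : Set ℓb} {C : Set ℓc} {f : C → A} {g : C → B}
                      {D : Set ℓ} (con : PushoutConstructors f g D)
                      (P : D → Set ℓ′) : Set (ℓa ⊔ ℓb ⊔ ℓc ⊔ ℓ′) where
  open PushoutConstructors con
  field
    inl′  : ∀ x → P (inl x)
    inr′  : ∀ y → P (inr y)
    glue′ : ∀ c → PathOver P (glue c) (inl′ (f c)) (inr′ (g c))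

record Pushout {A : Set ℓa} {B : Set ℓb} {C : Set ℓc} (f : C → A) (g : C → B) : Setω where
  field
    Carrier      : Set (ℓa ⊔ ℓb ⊔ ℓc)
    constructors : PushoutConstructors f g Carrier
  open PushoutConstructors constructors public
  open PushoutMethods
  field
    ind      : {ℓ′ : Level} (P : Carrier → Set ℓ′) → PushoutMethods constructors P → ∀ z → P z
    ind-inl  : {ℓ′ : Level} (P : Carrier → Set ℓ′) (m : PushoutMethods constructors P) →
               ∀ x → ind P m (inl x) ≡ inl′ m x
    ind-inr  : {ℓ′ : Level} (P : Carrier → Set ℓ′) (m : PushoutMethods constructors P) →
               ∀ y → ind P m (inr y) ≡ inr′ m y
    ind-glue : {ℓ′ : Level} (P : Carrier → Set ℓ′) (m : PushoutMethods constructors P) →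
               ∀ c → dcong (ind P m) (glue c) ∙ ind-inr P m (g c) ≡
                     cong (subst P (glue c)) (ind-inl P m (f c)) ∙ glue′ m c

Suspension : Set ℓ → Setω
Suspension A = Pushout {C = A} (λ _ → tt) (λ _ → tt)

-- Suspensions are unique up to equivalence, so quantifying over all of them
-- says that the suspension is contractible.
Acyclic : Set ℓ → Setω
Acyclic A = (S : Suspension A) → isContr (Pushout.Carrier S)

{-# OPTIONS --without-K #-}
-- The suspension is contractible once its meridians are all equal to the one
-- at pt.  Taking meridians sends the constructors of X to two loops α, β in
-- an identity type N ≡ S, where loops commute by the Eckmann–Hilton argument.
-- Hence the relation β³ = (αβ)² amounts to β = α², after which α⁵ = β³ amounts
-- to 1 = α; so (α, β, r, s) ranges over a contractible type, and may be
-- replaced by (1, 1, refl, refl), where the induction on X is trivial.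
module Submission where

open import Level using (Level)
open import Defs

open import Algebra.Bundles using (CommutativeMonoid)
import Algebra.Properties.CommutativeMonoid.Mult as Mult
open import Data.Nat.Base using (ℕ; zero; suc)
open import Data.Product.Base using (_,_)
open import Data.Unit.Base using (tt)
open import Function.Base using (_∘_)
open import Relation.Binary.PropositionalEquality
  using (_≡_; refl; sym; cong; cong₂; subst; subst₂; trans-assoc; trans-reflʳ; trans-symʳ; cong-id;
         naturality; isEquivalence; module ≡-Reasoning)

private
  variable
    ℓ ℓ′ ℓ″ : Level

Commutative : {A : Set ℓ} → A → Set ℓ
Commutative {A = A} p = (α β : Ω A p) → α ∙ β ≡ β ∙ α

module _ {A : Set ℓ} where

  -- Naturality of the right unit law, whose component at `refl` is `refl`.
  cong-∙refl : {x : A} (β : Ω (x ≡ x) refl) → cong (_∙ refl) β ≡ β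
  cong-∙refl β = begin
    cong (_∙ refl) β         ≡⟨ trans-reflʳ _ ⟨
    cong (_∙ refl) β ∙ refl  ≡⟨ naturality {x≡y = β} trans-reflʳ ⟩
    cong (λ q → q) β         ≡⟨ cong-id β ⟩
    β                        ∎
    where open ≡-Reasoning

  -- Whiskering β by q is a homotopy from the identity to itself; the claim is
  -- its naturality along α.
  eckmann-hilton : {x y : A} (p : x ≡ y) → Commutative p
  eckmann-hilton refl α β = begin
    α ∙ β                               ≡⟨ cong₂ _∙_ (cong-id α) (cong-∙refl β) ⟨
    cong (λ q → q) α ∙ cong (_∙ refl) β ≡⟨ naturality {x≡y = α} (λ q → cong (_∙ q) β) ⟩
    cong (_∙ refl) β ∙ cong (λ q → q) α ≡⟨ cong₂ _∙_ (cong-∙refl β) (cong-id α) ⟩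
    β ∙ α                               ∎
    where open ≡-Reasoning

cong-conjugate : {A : Set ℓ} {f : A → A} (h : ∀ x → f x ≡ x) {x y : A} (t : x ≡ y) →
                 cong f t ≡ h x ∙ t ∙ sym (h y)
cong-conjugate h {x} refl = sym (trans-symʳ (h x))

conjugate-inverse : {A : Set ℓ} {x x′ y y′ : A} (u : x ≡ x′) (e : x ≡ y) (v : y ≡ y′) →
                    u ∙ (sym u ∙ (e ∙ refl) ∙ v) ∙ sym v ≡ e ∙ refl
conjugate-inverse refl refl refl = refl

module _ {A : Set ℓ} {x y : A} where

  -- In use, `w` is one side of a relation and `c` its regrouping into a product that ends in `γ`.
  ∙-cancelʳ : {z : A} {p q : x ≡ y} {w : x ≡ z} (γ : y ≡ z) →
              w ≡ q ∙ γ → p ∙ γ ≡ w → p ≡ q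
  ∙-cancelʳ refl c e = sym (trans-reflʳ _) ∙ (e ∙ c) ∙ trans-reflʳ _

  ∙-whiskerʳ : {z : A} {p q : x ≡ y} {w : x ≡ z} (γ : y ≡ z) →
               w ≡ q ∙ γ → p ≡ q → p ∙ γ ≡ w
  ∙-whiskerʳ γ c e = cong (_∙ γ) e ∙ sym c

  -- Hence an arbitrary relation `e` may be taken to be whiskered from some `p ≡ q`, on which path
  -- induction can act. For `γ` and `c` equal to `refl`, whiskering conjugates by the right unit
  -- law, which `∙-cancelʳ` undoes.
  ∙-whiskerʳ-cancelʳ : {z : A} {p q : x ≡ y} {w : x ≡ z} (γ : y ≡ z)
                       (c : w ≡ q ∙ γ) (e : p ∙ γ ≡ w) →
                       ∙-whiskerʳ γ c (∙-cancelʳ γ c e) ≡ e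
  ∙-whiskerʳ-cancelʳ {p = p} {q} refl refl e = begin
    cong (_∙ refl) t ∙ refl                       ≡⟨ trans-reflʳ _ ⟩
    cong (_∙ refl) t                              ≡⟨ cong-conjugate trans-reflʳ t ⟩
    trans-reflʳ p ∙ t ∙ sym (trans-reflʳ q)       ≡⟨ conjugate-inverse (trans-reflʳ p) e (trans-reflʳ q) ⟩
    e ∙ refl                                      ≡⟨ trans-reflʳ e ⟩
    e                                             ∎
    where
    open ≡-Reasoning
    t = sym (trans-reflʳ p) ∙ (e ∙ refl) ∙ trans-reflʳ q

module _ {A : Set ℓ} {p : A} (comm : Commutative p) where

  -- In the library's additive notation, `n × α` unfolds to `α ^ n` for each numeral `n`, so its
  -- laws of multiples become laws of powers.
  loops : CommutativeMonoid ℓ ℓ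
  loops = record
    { Carrier = Ω A p
    ; _≈_     = _≡_
    ; _∙_     = _∙_
    ; ε       = refl
    ; isCommutativeMonoid = record
      { isMonoid = record
        { isSemigroup = record
          { isMagma = record { isEquivalence = isEquivalence ; ∙-cong = cong₂ _∙_ }
          ; assoc   = λ α β γ → trans-assoc α
          }
        ; identity = (λ _ → refl) , trans-reflʳ
        }
      ; comm = comm
      }
    }
  open Mult loops using (×-distrib-+; ×-assocˡ)

  constructors-at : (α β : Ω A p) → α ^ 5 ≡ β ^ 3 → β ^ 3 ≡ (α ∙ β) ^ 2 → XConstructors A
  constructors-at α β r s = record { pt = p ; a = α ; b = β ; r = r ; s = s }

  square-∙ : (α β : Ω A p) → (α ∙ β) ^ 2 ≡ α ^ 2 ∙ β ^ 2
  square-∙ α β = ×-distrib-+ α β 2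

  square-cube : (α : Ω A p) → (α ^ 2) ^ 3 ≡ α ∙ α ^ 5
  square-cube α = ×-assocˡ α 3 2

  -- `β ^ 3` unfolds to `β ∙ β ^ 2`, so the common factor is `β ^ 2`.
  s-at : (α β : Ω A p) → β ≡ α ^ 2 → β ^ 3 ≡ (α ∙ β) ^ 2
  s-at α β = ∙-whiskerʳ (β ^ 2) (square-∙ α β)

  -- The form of `r` once `β` is `α ^ 2`: the left side is `refl ∙ α ^ 5` by definition, the right
  -- side regroups as `α ∙ α ^ 5`.
  r-at : (α : Ω A p) → refl ≡ α → α ^ 5 ≡ (α ^ 2) ^ 3
  r-at α = ∙-whiskerʳ (α ^ 5) (square-cube α)

  -- The relations are those left by the two path inductions, so that `solve-α` ends in `refl`.
  centre : XConstructors A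
  centre = constructors-at refl refl (r-at refl refl) (s-at refl refl refl)

  constructors≡centre : ∀ α β r s → constructors-at α β r s ≡ centre
  constructors≡centre α β r s =
    subst (λ s → constructors-at α β r s ≡ centre)
          (∙-whiskerʳ-cancelʳ (β ^ 2) (square-∙ α β) s)
          (solve-β β (∙-cancelʳ (β ^ 2) (square-∙ α β) s) r)
    where
    solve-α : ∀ α (e : refl ≡ α) →
              constructors-at α (α ^ 2) (r-at α e) (s-at α (α ^ 2) refl) ≡ centre
    solve-α _ refl = refl

    -- `r` is generalised with `β`, since its type changes as `β` becomes `α ^ 2`.
    solve-β : ∀ β (e : β ≡ α ^ 2) r → constructors-at α β r (s-at α β e) ≡ centre
    solve-β _ refl r =
      subst (λ r → constructors-at α (α ^ 2) r (s-at α (α ^ 2) refl) ≡ centre)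
            (∙-whiskerʳ-cancelʳ (α ^ 5) (square-cube α) r)
            (solve-α α (∙-cancelʳ (α ^ 5) (square-cube α) r))

based-methods : {A : Set ℓ} (con : XConstructors A) → Commutative (XConstructors.pt con) →
                XMethods con (_≡ XConstructors.pt con)
based-methods con comm =
  subst (λ c → XMethods c (_≡ pt)) (sym trivial)
        -- Over constant loops every transport reduces, so `refl` serves for all five methods.
        (record { pt′ = refl ; a′ = refl ; b′ = refl ; r′ = refl ; s′ = refl })
  where
  open XConstructors con
  trivial : con ≡ constructors-at comm refl refl refl refl
  trivial = constructors≡centre comm a b r s ∙ sym (constructors≡centre comm refl refl refl refl)

module _ {A : Set ℓ} {B : Set ℓ′} (f : A → B) where

  cong-∙-≡ : {x y z : A} {p : x ≡ y} {q : y ≡ z} {p′ : f x ≡ f y} {q′ : f y ≡ f z} →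
             cong f p ≡ p′ → cong f q ≡ q′ → cong f (p ∙ q) ≡ p′ ∙ q′
  cong-∙-≡ {p = refl} refl e = e

  cong-^-≡ : {x : A} {p : Ω A x} {p′ : Ω B (f x)} →
             cong f p ≡ p′ → (n : ℕ) → cong f (p ^ n) ≡ p′ ^ n
  cong-^-≡ e zero    = refl
  cong-^-≡ e (suc n) = cong-∙-≡ e (cong-^-≡ e n)

  cong²-≡ : {x y : A} {p q : x ≡ y} {p′ q′ : f x ≡ f y} →
            cong f p ≡ p′ → cong f q ≡ q′ → p ≡ q → p′ ≡ q′
  cong²-≡ e e′ r = sym e ∙ cong (cong f) r ∙ e′

  image : XConstructors A → XConstructors B
  image con = record
    { pt = f pt
    ; a  = cong f a
    ; b  = cong f b
    -- `cong f` preserves composites only up to identification, so both relations are corrected at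
    -- their ends.
    ; r  = cong²-≡ (cong-^-≡ {p = a} refl 5) (cong-^-≡ {p = b} refl 3) r
    ; s  = cong²-≡ (cong-^-≡ {p = b} refl 3) (cong-^-≡ {p = a ∙ b} (cong-∙-≡ {p = a} refl refl) 2) s
    }
    where open XConstructors con

  module _ (P : B → Set ℓ″) where

    private
      Q : A → Set ℓ″
      Q = P ∘ f

    -- `p′` is kept apart from `cong f p` so that a path over `cong f a ^ 5` can be pulled back to
    -- one over `a ^ 5`.
    pullback : {x y : A} {p : x ≡ y} {p′ : f x ≡ f y} {u : P (f x)} {v : P (f y)} →
               cong f p ≡ p′ → PathOver P p′ u v → PathOver Q p u v
    pullback {p = refl} refl h = h

    pullback-∙ : {x y z : A} {p : x ≡ y} {q : y ≡ z} {p′ : f x ≡ f y} {q′ : f y ≡ f z}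
                 {u : P (f x)} {v : P (f y)} {w : P (f z)}
                 (e : cong f p ≡ p′) (e′ : cong f q ≡ q′)
                 (h : PathOver P p′ u v) (k : PathOver P q′ v w) →
                 pullback (cong-∙-≡ e e′) (_∙ᵈ_ {P = P} {p = p′} h k) ≡
                 _∙ᵈ_ {P = Q} {p = p} (pullback e h) (pullback e′ k)
    pullback-∙ {p = refl} {refl} refl refl h k = refl

    pullback-^ : {x : A} {p : Ω A x} {p′ : Ω B (f x)} {u : P (f x)}
                 (e : cong f p ≡ p′) (h : PathOver P p′ u u) (n : ℕ) →
                 pullback (cong-^-≡ e n) (_^ᵈ_ {P = P} h n) ≡ _^ᵈ_ {P = Q} (pullback e h) n
    pullback-^ e h zero = refl
    pullback-^ {p = p} {p′} e h (suc n) =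
      pullback-∙ e (cong-^-≡ e n) h (_^ᵈ_ {P = P} h n) ∙
      cong (_∙ᵈ_ {P = Q} {p = p} (pullback e h)) (pullback-^ e h n)

    pullback² : {x y : A} {p q : x ≡ y} {p′ q′ : f x ≡ f y} {u : P (f x)} {v : P (f y)}
                {h : PathOver P p′ u v} {k : PathOver P q′ u v}
                (e : cong f p ≡ p′) (e′ : cong f q ≡ q′) (r : p ≡ q) →
                PathOver² P (cong²-≡ e e′ r) h k →
                PathOver² Q r (pullback e h) (pullback e′ k)
    pullback² {p = refl} refl refl refl h≡k = h≡k

    pullback-methods : (con : XConstructors A) → XMethods (image con) P → XMethods con Q
    pullback-methods con m = record
      { pt′ = pt′
      ; a′  = pullback {p = a} refl a′
      ; b′  = pullback {p = b} refl b′
      -- `pullback²` relates pullbacks of whole powers; `subst₂` turns these into powers of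
      -- pullbacks.
      ; r′  = subst₂ (PathOver² Q r) (pullback-^ refl a′ 5) (pullback-^ refl b′ 3)
                (pullback² (cong-^-≡ {p = a} refl 5) (cong-^-≡ {p = b} refl 3) r r′)
      ; s′  = subst₂ (PathOver² Q s) (pullback-^ refl b′ 3)
                (pullback-^ (cong-∙-≡ {p = a} refl refl) (_∙ᵈ_ {P = P} {p = cong f a} a′ b′) 2 ∙
                 cong (λ h → _^ᵈ_ {P = Q} h 2) (pullback-∙ {p = a} refl refl a′ b′))
                (pullback² (cong-^-≡ {p = b} refl 3)
                  (cong-^-≡ {p = a ∙ b} (cong-∙-≡ {p = a} refl refl) 2) s s′)
      }
      where
      open XConstructors con
      open XMethods m

subst-based : {A : Set ℓ} {x y : A} (p : x ≡ y) → PathOver (x ≡_) p refl p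
subst-based refl = refl

proposition7p3 : (ℓ : Level) (H : XHIT ℓ) → Acyclic (XHIT.X H)
proposition7p3 ℓ H S = inl tt , S.ind (inl tt ≡_) (record
  { inl′  = λ _ → refl
  -- With the meridian at `pt` chosen here, the condition over `glue x` says that the meridian at
  -- `x` equals it.
  ; inr′  = λ _ → glue pt
  ; glue′ = λ x → subst-based (glue x) ∙ glue≡glue-pt x
  })
  where
  module S = Pushout S
  open S using (inl; glue)
  open XHIT H
  open XConstructors constructors using (pt)

  glue≡glue-pt : ∀ x → glue x ≡ glue pt
  glue≡glue-pt = ind (λ x → glue x ≡ glue pt)
    -- The methods are found in `inl tt ≡ inr tt`, where loops at `glue pt` commute, and pulled back
    -- to `X` along `glue`.
    (pullback-methods glue (_≡ glue pt) constructors
      (based-methods (image glue constructors) (eckmann-hilton (glue pt))))
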